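{- Let $m\ge 3$ and $s$ be odd positive integers and $n=sm$. Define automorphisms of $\Gamma=C_n[mK_1]$ $$\sigma_1=(1,1,\dots,1,tc^{ -1})r,\qquad \sigma_2=(t,\beta_2,\beta_3,\dots,\beta_n)z,\quad\text{where } \beta_i=c^{(-1)^{i-1}(2i-3)}\ (2\le i\le n)$$ (so $\sigma_2=(t,c^{ -1},c^{3},c^{ -5},\dots,c^5,c^{ -3})z$), and let $G=\langle\sigma_1,\sigma_2\rangle$. Then $\sigma_1$ has order $2n$, $\sigma_2$ has order $2m$, $\sigma_1\sigma_2$ has order $2$, and $|G|=4m^2n$.
   Context: $C_n[mK_1]$ has vertex set $\{1,\dots,n\}\times\{1,\dots,m\}$ with $(i_1,j_1)\sim(i_2,j_2)$ iff $i_1\equiv i_2\pm1\pmod n$ (residues mod $n$ represented by $1,\dots,n$, mod $m$ by $1,\dots,m$). For $\alpha_i\in S_m$ and a permutation $x$ of $\{1,\dots,n\}$, $(\alpha_1,\dots,\alpha_n)x$ is the vertex permutation $(i,j)\mapsto(ix,j\alpha_i)$; permutations act on the right and products are composed left to right. $c=(1\,2\,\cdots\,m)$, $t\in S_m$ fixes $1$ and swaps $j\leftrightarrow m-j+2$ for $2\le j\le m$, $r=(1\,2\,\cdots\,n)$, and $z$ fixes $1$ and swaps $j\leftrightarrow n-j+2$ for $2\le j\le n$. -}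

module Defs where

open import Data.Nat as ℕ using (ℕ; zero; suc; _≤_; _<_; _∸_)
open import Data.Integer as ℤ using (ℤ; +_; -1ℤ; 1ℤ)
open import Data.Integer.DivMod using (n%ℕd<d)
open import Data.Fin using (Fin; toℕ; fromℕ<)
open import Data.Bool using (if_then_else_)
open import Data.Product using (_×_; _,_; Σ; ∃)
open import Data.List using (List; length)
open import Data.List.Relation.Unary.All using (All)
open import Data.List.Relation.Unary.Any using (Any)
open import Data.List.Relation.Unary.AllPairs using (AllPairs)
open import Relation.Binary.PropositionalEquality using (_≡_)
open import Relation.Nullary using (¬_)
open import Function using (_∘_; id)

-- Odd natural numbers
Odd : ℕ → Set
Odd k = ∃ λ q → k ≡ suc (2 ℕ.* q)

-- Residue labels: a label ℓ ∈ {1,…,k} is represented by (ℓ - 1) : Fin k.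
-- The integer a, read modulo k, as an element of Fin k (k ≠ 0 is witnessed
-- by the argument of type Fin k, which is only used to split on k).
modFin : ∀ {k} → Fin k → ℤ → Fin k
modFin {suc k} _ a = fromℕ< (n%ℕd<d a (suc k))

-- label (1-indexed) of an element of Fin k
lbl : ∀ {k} → Fin k → ℕ
lbl i = suc (toℕ i)

-- cyclic permutation (1 2 ⋯ k) and its integer powers: label ℓ ↦ ℓ + e (mod k)
cpow : ∀ {k} → ℤ → Fin k → Fin k
cpow e j = modFin j (+ toℕ j ℤ.+ e)

-- the cycle (1 2 ⋯ k)   (this is c for k = m and r for k = n)
cyc : ∀ {k} → Fin k → Fin k
cyc = cpow 1ℤ

-- fixes 1 and swaps ℓ ↔ k - ℓ + 2 for 2 ≤ ℓ ≤ k  (this is t for k = m, z for k = n)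
flip : ∀ {k} → Fin k → Fin k
flip {k} j = if toℕ j ℕ.≡ᵇ 0 then j else modFin j (+ (k ∸ toℕ j))

-- vertices of C_n[mK_1]
V : ℕ → ℕ → Set
V n m = Fin n × Fin m

-- the vertex permutation (α_1,…,α_n)x : (i,j) ↦ (ix, jα_i)
wr : ∀ {n m} → (Fin n → Fin m → Fin m) → (Fin n → Fin n) → V n m → V n m
wr α x (i , j) = (x i , α i j)

-- left-to-right composition: f ⨾ g applies f first, then g
infixl 9 _⨾_
_⨾_ : ∀ {A : Set} → (A → A) → (A → A) → A → A
(f ⨾ g) = g ∘ f

-- pointwise equality of vertex maps
infix 4 _≈_
_≈_ : ∀ {A : Set} → (A → A) → (A → A) → Set
f ≈ g = ∀ v → f v ≡ g v

-- k-th power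
pow : ∀ {A : Set} → (A → A) → ℕ → A → A
pow f zero = id
pow f (suc k) = pow f k ⨾ f

-- f has order k
HasOrder : ∀ {A : Set} → (A → A) → ℕ → Set
HasOrder f k = (1 ≤ k) × (pow f k ≈ id) × (∀ j → 1 ≤ j → j < k → ¬ (pow f j ≈ id))

-- σ₁ = (1,1,…,1, t c⁻¹) r
σ₁ : ∀ n m → V n m → V n m
σ₁ n m = wr α cyc
  where
  α : Fin n → Fin m → Fin m
  α i = if lbl i ℕ.≡ᵇ n then (flip ⨾ cpow -1ℤ) else id

-- σ₂ = (t, β₂, …, β_n) z  with  β_i = c^((-1)^(i-1) (2i-3))
σ₂ : ∀ n m → V n m → V n m
σ₂ n m = wr α flip
  where
  α : Fin n → Fin m → Fin m
  α i = if lbl i ℕ.≡ᵇ 1 then flip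
        else cpow ((ℤ.- 1ℤ) ℤ.^ (lbl i ∸ 1) ℤ.* (+ (2 ℕ.* lbl i) ℤ.- + 3))

-- the subgroup ⟨a , b⟩ of Sym(A) (elements up to pointwise equality)
data InGen {A : Set} (a b : A → A) : (A → A) → Set where
  g-id  : InGen a b id
  g-a   : InGen a b a
  g-b   : InGen a b b
  g-mul : ∀ {f g} → InGen a b f → InGen a b g → InGen a b (f ⨾ g)
  g-inv : ∀ {f g} → InGen a b f → (f ⨾ g) ≈ id → (g ⨾ f) ≈ id → InGen a b g
  g-ext : ∀ {f g} → InGen a b f → f ≈ g → InGen a b g

-- a set P of maps (up to ≈) has exactly N elements
HasCard : ∀ {A : Set} → ((A → A) → Set) → ℕ → Set
HasCard {A} P N = Σ (List (A → A)) λ L →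
  (length L ≡ N) × All P L × AllPairs (λ f g → ¬ (f ≈ g)) L
  × (∀ f → P f → Any (λ g → f ≈ g) L)

module Submission where

-- Write y = (-1)^i (2j + 1) for the vertex (i , j), labels counted from 0.  In the coordinates (i , y)
-- σ₁ is (i , y) ↦ (i + 1 , -y) and σ₂ is (i , y) ↦ (-i , -y - 4i + 2): the sign (-1)^i absorbs the
-- alternating exponents of the β_i, and as n is odd the factor t c⁻¹ on the last copy absorbs the
-- wrap-around of i.  Both are maps (i , y) ↦ (±i + b , ±y + l i + u) with b read modulo n and l, u
-- modulo m, which makes sense because m divides n; the change of coordinates is invertible because 2 is
-- invertible modulo m.  These maps form a group of order 2n · 2m · m in which the orders are computed
-- from closed forms of powers, and ⟨σ₁ , σ₂⟩ is all of it: it contains the translation i ↦ i + 1 and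
-- the flip y ↦ -y (powers of σ₁), every shear y ↦ y + l i (powers of σ₂², the shear by 8, which is
-- invertible modulo m), every lift y ↦ y + u (commutators of translation and shear), and the flip i ↦ -i.

open import Defs

-- An anonymous module, so that the integer operators opened inside do not clash with the
-- natural-number operators of the statement at the end.
module _ where

  open import Data.Nat as ℕ using (ℕ; zero; suc; _<_; _≤_; _∸_; s≤s; z≤n)
  import Data.Nat.Properties as ℕ
  open import Data.Nat.DivMod using (_%_; m<n⇒m%n≡m; [m+kn]%n≡m%n)
  import Data.Nat.Tactic.RingSolver as ℕ-Solver
  open import Data.Integer as ℤ using (ℤ; +_; -[1+_]; _+_; _*_; -_; _-_; 0ℤ; 1ℤ; -1ℤ; _◃_; _%ℕ_; _/ℕ_)
  import Data.Integer.Properties as ℤ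
  open import Data.Integer.DivMod using (n%ℕd<d; a≡a%ℕn+[a/ℕn]*n)
  open import Data.Integer.Divisibility.Signed using (_∣_; divides; ∣-trans; ∣m∣n⇒∣m+n; ∣m⇒∣-m; ∣n⇒∣m*n)
  open import Data.Integer.Tactic.RingSolver using (solve-∀)
  open import Data.Sign as Sign using (Sign)
  import Data.Sign.Properties as Sign
  open import Data.Fin as Fin using (Fin; toℕ; fromℕ<; zero; suc)
  import Data.Fin.Properties as Fin
  open import Data.Bool using (if_then_else_)
  open import Data.Product using (Σ; _,_; _×_; proj₁; proj₂)
  open import Data.Sum using (_⊎_; inj₁; inj₂)
  open import Data.List using (List; []; _∷_; length; map; cartesianProduct; allFin)
  import Data.List.Properties as List
  import Data.List.Relation.Unary.All as All
  import Data.List.Relation.Unary.All.Properties as All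
  open import Data.List.Relation.Unary.All using ([]; _∷_)
  import Data.List.Relation.Unary.Any as Any
  import Data.List.Relation.Unary.Any.Properties as Any
  open import Data.List.Relation.Unary.Any using (here; there)
  import Data.List.Relation.Unary.AllPairs as AllPairs
  import Data.List.Relation.Unary.AllPairs.Properties as AllPairs
  open import Data.List.Relation.Unary.AllPairs using ([]; _∷_)
  open import Data.List.Relation.Unary.Unique.Propositional using (Unique)
  open import Data.List.Relation.Unary.Unique.Propositional.Properties using (cartesianProduct⁺; allFin⁺)
  open import Data.List.Membership.Propositional using (_∈_)
  open import Data.List.Membership.Propositional.Properties using (∈-cartesianProduct⁺; ∈-allFin)
  open import Function using (id; _∘_)
  open import Relation.Nullary using (¬_; yes; no; contradiction)
  open import Relation.Nullary.Decidable using (dec-true; dec-false)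
  open import Relation.Binary.Bundles using (Setoid)
  open import Relation.Binary.Structures using (IsEquivalence)
  open import Relation.Binary.PropositionalEquality
  import Relation.Binary.Reasoning.Setoid as SetoidReasoning

  -- Congruences and residues

  infix 4 _≡_mod_
  -- A record rather than a definition, so that a, b and k can be inferred from a proof.
  record _≡_mod_ (a b : ℤ) (k : ℕ) : Set where
    constructor congruent
    field divides-difference : + k ∣ a - b

  module _ {k : ℕ} where

    private
      ∣-respʳ : ∀ {x y} → x ≡ y → + k ∣ x → + k ∣ y
      ∣-respʳ = subst (+ k ∣_)

    mod-reflexive : ∀ {a b} → a ≡ b → a ≡ b mod k
    mod-reflexive {a} refl = congruent (divides 0ℤ (ℤ.+-inverseʳ a))

    mod-refl : ∀ {a} → a ≡ a mod k
    mod-refl = mod-reflexive refl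

    mod-sym : ∀ {a b} → a ≡ b mod k → b ≡ a mod k
    mod-sym {a} {b} (congruent p) = congruent (∣-respʳ (ring a b) (∣m⇒∣-m p))
      where ring : ∀ a b → - (a - b) ≡ b - a
            ring = solve-∀

    mod-trans : ∀ {a b c} → a ≡ b mod k → b ≡ c mod k → a ≡ c mod k
    mod-trans {a} {b} {c} (congruent p) (congruent q) = congruent (∣-respʳ (ring a b c) (∣m∣n⇒∣m+n p q))
      where ring : ∀ a b c → (a - b) + (b - c) ≡ a - c
            ring = solve-∀

    mod-isEquivalence : IsEquivalence (λ a b → a ≡ b mod k)
    mod-isEquivalence = record { refl = mod-refl ; sym = mod-sym ; trans = mod-trans }

    mod-setoid : Setoid _ _
    mod-setoid = record { isEquivalence = mod-isEquivalence }

    +-cong-mod : ∀ {a b c d} → a ≡ b mod k → c ≡ d mod k → a + c ≡ b + d mod k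
    +-cong-mod {a} {b} {c} {d} (congruent p) (congruent q) =
      congruent (∣-respʳ (ring a b c d) (∣m∣n⇒∣m+n p q))
      where ring : ∀ a b c d → (a - b) + (c - d) ≡ (a + c) - (b + d)
            ring = solve-∀

    neg-cong-mod : ∀ {a b} → a ≡ b mod k → - a ≡ - b mod k
    neg-cong-mod {a} {b} (congruent p) = congruent (∣-respʳ (ring a b) (∣m⇒∣-m p))
      where ring : ∀ a b → - (a - b) ≡ - a - - b
            ring = solve-∀

    *-congˡ-mod : ∀ x {a b} → a ≡ b mod k → x * a ≡ x * b mod k
    *-congˡ-mod x {a} {b} (congruent p) = congruent (∣-respʳ (ring x a b) (∣n⇒∣m*n x p))
      where ring : ∀ x a b → x * (a - b) ≡ x * a - x * b
            ring = solve-∀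

    *-cong-mod : ∀ {a b c d} → a ≡ b mod k → c ≡ d mod k → a * c ≡ b * d mod k
    *-cong-mod {a} {b} {c} {d} p q = mod-trans (*-congˡ-mod a q) (mod-trans
      (mod-reflexive (ℤ.*-comm a d)) (mod-trans (*-congˡ-mod d p) (mod-reflexive (ℤ.*-comm d b))))

    multiple≡0-mod : ∀ q → q * + k ≡ 0ℤ mod k
    multiple≡0-mod q = congruent (divides q (ℤ.+-identityʳ (q * + k)))

    modulus≡0-mod : + k ≡ 0ℤ mod k
    modulus≡0-mod = mod-trans (mod-reflexive (sym (ℤ.*-identityˡ (+ k)))) (multiple≡0-mod 1ℤ)

  module ≡-mod-Reasoning (k : ℕ) = SetoidReasoning (mod-setoid {k})

  mod-weaken : ∀ s {m a b} → a ≡ b mod (s ℕ.* m) → a ≡ b mod m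
  mod-weaken s {m} (congruent p) = congruent (∣-trans (divides (+ s) (ℤ.pos-* s m)) p)

  toℤ : ∀ {k} → Fin k → ℤ
  toℤ x = + toℕ x

  residue-uniqueℕ : ∀ {k r₁ r₂} q → r₁ < k → r₂ < k → r₁ ≡ r₂ ℕ.+ q ℕ.* k → r₁ ≡ r₂
  residue-uniqueℕ {suc k} {r₁} {r₂} q r₁<k r₂<k eq = begin
    r₁                         ≡⟨ m<n⇒m%n≡m r₁<k ⟨
    r₁ % suc k                 ≡⟨ cong (_% suc k) eq ⟩
    (r₂ ℕ.+ q ℕ.* suc k) % suc k ≡⟨ [m+kn]%n≡m%n r₂ q (suc k) ⟩
    r₂ % suc k                 ≡⟨ m<n⇒m%n≡m r₂<k ⟩
    r₂                         ∎
    where open ≡-Reasoning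

  private
    quotient-shift : ∀ {k} a b z → a - b ≡ z * + k → a ≡ b + z * + k
    quotient-shift {k} a b z e = trans (ring a b) (cong (λ x → b + x) e)
      where ring : ∀ a b → a ≡ b + (a - b)
            ring = solve-∀

    quotient-flip : ∀ {k} a b z → a ≡ b + (- z) * + k → b ≡ a + z * + k
    quotient-flip {k} a b z e = trans (ring a b z (+ k)) (cong (_+ z * + k) (sym e))
      where ring : ∀ a b z K → b ≡ (b + (- z) * K) + z * K
            ring = solve-∀

    pos-shift : ∀ {k a b} q → + a ≡ + b + + q * + k → a ≡ b ℕ.+ q ℕ.* k
    pos-shift {k} {a} {b} q e =
      ℤ.+-injective (trans e (sym (trans (ℤ.pos-+ b (q ℕ.* k)) (cong (λ x → + b + x) (ℤ.pos-* q k)))))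

  residue-unique : ∀ {k r₁ r₂} → r₁ < k → r₂ < k → + r₁ ≡ + r₂ mod k → r₁ ≡ r₂
  residue-unique {k} {r₁} {r₂} r₁<k r₂<k (congruent (divides (+ q) eq)) =
    residue-uniqueℕ q r₁<k r₂<k (pos-shift {k} q (quotient-shift (+ r₁) (+ r₂) (+ q) eq))
  residue-unique {k} {r₁} {r₂} r₁<k r₂<k (congruent (divides -[1+ q ] eq)) =
    sym (residue-uniqueℕ (suc q) r₂<k r₁<k (pos-shift {k} (suc q)
      (quotient-flip {k} (+ r₁) (+ r₂) (+ suc q) (quotient-shift (+ r₁) (+ r₂) -[1+ q ] eq))))

  toℤ-modFin : ∀ {k} (x : Fin k) a → toℤ (modFin x a) ≡ a mod k
  toℤ-modFin {suc k} _ a = congruent (divides (- (a /ℕ suc k)) (trans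
    (cong (λ r → + r - a) (Fin.toℕ-fromℕ< (n%ℕd<d a (suc k))))
    (ring (+ (a %ℕ suc k)) (a /ℕ suc k) a (a≡a%ℕn+[a/ℕn]*n a (suc k)))))
    where ring : ∀ r q a → a ≡ r + q * + suc k → r - a ≡ (- q) * + suc k
          ring r q a e = trans (cong (λ x → r - x) e) (solve r q (+ suc k))
            where solve : ∀ r q K → r - (r + q * K) ≡ (- q) * K
                  solve = solve-∀

  toℕ-modFin : ∀ {k r} (x : Fin k) {a} → r < k → a ≡ + r mod k → toℕ (modFin x a) ≡ r
  toℕ-modFin x {a} r<k p = residue-unique (Fin.toℕ<n (modFin x a)) r<k (mod-trans (toℤ-modFin x a) p)

  toℤ-injective-mod : ∀ {k} {x y : Fin k} → toℤ x ≡ toℤ y mod k → x ≡ y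
  toℤ-injective-mod {x = x} {y} p = Fin.toℕ-injective (residue-unique (Fin.toℕ<n x) (Fin.toℕ<n y) p)

  modFin-cong : ∀ {k} (x y : Fin k) {a b} → a ≡ b mod k → modFin x a ≡ modFin y b
  modFin-cong x y {a} {b} p = toℤ-injective-mod
    (mod-trans (toℤ-modFin x a) (mod-trans p (mod-sym (toℤ-modFin y b))))

  modFin-unique : ∀ {k} (x : Fin k) {a y} → a ≡ toℤ y mod k → modFin x a ≡ y
  modFin-unique x {a} p = toℤ-injective-mod (mod-trans (toℤ-modFin x a) p)

  modFin-injective : ∀ {k} (x y : Fin k) {a b} → modFin x a ≡ modFin y b → a ≡ b mod k
  modFin-injective x y {a} {b} e =
    mod-trans (mod-sym (toℤ-modFin x a)) (mod-trans (mod-reflexive (cong toℤ e)) (toℤ-modFin y b))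

  +-cancelʳ-mod : ∀ {k a b c d} → a + c ≡ b + d mod k → c ≡ d mod k → a ≡ b mod k
  +-cancelʳ-mod {k} {a} {b} {c} {d} p q =
    mod-trans (mod-reflexive (ring a c)) (mod-trans (+-cong-mod p (neg-cong-mod q)) (mod-reflexive (sym (ring b d))))
    where ring : ∀ x y → x ≡ x + y + - y
          ring = solve-∀

  toℤ-fromℕ< : ∀ {k r} (r<k : r < k) → toℤ (fromℕ< r<k) ≡ + r
  toℤ-fromℕ< r<k = cong +_ (Fin.toℕ-fromℕ< r<k)

  pos-∸ : ∀ {m n} → n ≤ m → + (m ∸ n) ≡ + m - + n
  pos-∸ {m} {n} n≤m = trans (sym (ℤ.⊖-≥ n≤m)) (sym (ℤ.m-n≡m⊖n m n))

  Even : ℕ → Set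
  Even k = Σ ℕ λ q → k ≡ 2 ℕ.* q

  even-or-odd : ∀ k → Even k ⊎ Odd k
  even-or-odd zero = inj₁ (0 , refl)
  even-or-odd (suc k) with even-or-odd k
  ... | inj₁ (q , refl) = inj₂ (q , refl)
  ... | inj₂ (q , refl) = inj₁ (suc q , cong suc (sym (ℕ.+-suc q (q ℕ.+ 0))))

  odd-* : ∀ {a b} → Odd a → Odd b → Odd (a ℕ.* b)
  odd-* (p , refl) (q , refl) = q ℕ.+ p ℕ.* suc (2 ℕ.* q) , ring p q
    where ring : ∀ p q → suc (2 ℕ.* p) ℕ.* suc (2 ℕ.* q) ≡ suc (2 ℕ.* (q ℕ.+ p ℕ.* suc (2 ℕ.* q)))
          ring = ℕ-Solver.solve-∀

  m<n⇒m<o*n : ∀ {o m n} → Odd o → m < n → m < o ℕ.* n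
  m<n⇒m<o*n {n = n} (q , refl) m<n = ℕ.<-≤-trans m<n (ℕ.m≤m+n n (2 ℕ.* q ℕ.* n))

  half-mod-odd : ∀ {m q} → m ≡ suc (2 ℕ.* q) → + 2 * + suc q ≡ 1ℤ mod m
  half-mod-odd {m} {q} refl = begin
    + 2 * + suc q            ≡⟨ ring (+ q) ⟩
    1ℤ + + 2 * + q + 1ℤ      ≡⟨ cong (λ x → 1ℤ + x + 1ℤ) (ℤ.pos-* 2 q) ⟨
    + m + 1ℤ                 ≈⟨ +-cong-mod modulus≡0-mod (mod-refl {a = 1ℤ}) ⟩
    0ℤ + 1ℤ                  ≡⟨⟩
    1ℤ                       ∎
    where
    open ≡-mod-Reasoning m
    ring : ∀ Q → + 2 * (1ℤ + Q) ≡ 1ℤ + + 2 * Q + 1ℤ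
    ring = solve-∀

  multiple<2n⇒≡n : ∀ {n j} → 1 ≤ j → j < 2 ℕ.* n → + j ≡ 0ℤ mod n → j ≡ n
  multiple<2n⇒≡n {n} {j} 1≤j j<2n j≡0 with j ℕ.<? n
  ... | yes j<n = contradiction (residue-unique j<n (ℕ.≤-<-trans z≤n j<n) j≡0) (ℕ.<⇒≢ 1≤j ∘ sym)
  ... | no j≮n = trans (sym (ℕ.m∸n+n≡m n≤j)) (cong (ℕ._+ n) j∸n≡0)
    where
    n≤j : n ≤ j
    n≤j = ℕ.≮⇒≥ j≮n
    j∸n<n : j ℕ.∸ n < n
    j∸n<n = subst (j ℕ.∸ n <_) (trans (ℕ.m+n∸m≡n n (n ℕ.+ 0)) (ℕ.+-identityʳ n)) (ℕ.∸-monoˡ-< j<2n n≤j)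
    j∸n≡0 : j ℕ.∸ n ≡ 0
    j∸n≡0 = residue-unique j∸n<n (ℕ.≤-<-trans z≤n j∸n<n) (mod-trans (mod-reflexive (pos-∸ n≤j))
      (mod-trans (+-cong-mod j≡0 (neg-cong-mod modulus≡0-mod)) (mod-refl {a = 0ℤ})))

  -- σ₁ and σ₂ in twisted coordinates

  sgn : ℕ → ℤ
  sgn k = (- 1ℤ) ℤ.^ k

  sgn-suc : ∀ k → sgn (suc k) ≡ - sgn k
  sgn-suc k = ℤ.-1*i≡-i (sgn k)

  sgn-even : ∀ q → sgn (2 ℕ.* q) ≡ 1ℤ
  sgn-even q = trans (sym (ℤ.^-*-assoc (- 1ℤ) 2 q)) (ℤ.^-zeroˡ q)

  sgn-odd : ∀ {N} → Odd N → sgn N ≡ -1ℤ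
  sgn-odd (q , refl) = trans (sgn-suc (2 ℕ.* q)) (cong -_ (sgn-even q))

  sgn*sgn : ∀ k → sgn k * sgn k ≡ 1ℤ
  sgn*sgn k = begin
    sgn k * sgn k       ≡⟨ ℤ.^-distribˡ-+-* (- 1ℤ) k k ⟨
    sgn (k ℕ.+ k)       ≡⟨ cong (λ e → sgn (k ℕ.+ e)) (ℕ.+-identityʳ k) ⟨
    sgn (2 ℕ.* k)       ≡⟨ sgn-even k ⟩
    1ℤ                  ∎
    where open ≡-Reasoning

  sgn-odd-∸ : ∀ {N I} → Odd N → I ≤ N → sgn (N ∸ I) ≡ - sgn I
  sgn-odd-∸ {N} {I} oddN I≤N = begin
    sgn (N ∸ I)                   ≡⟨ ℤ.*-identityʳ (sgn (N ∸ I)) ⟨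
    sgn (N ∸ I) * 1ℤ              ≡⟨ cong (sgn (N ∸ I) *_) (sgn*sgn I) ⟨
    sgn (N ∸ I) * (sgn I * sgn I) ≡⟨ ℤ.*-assoc (sgn (N ∸ I)) (sgn I) (sgn I) ⟨
    sgn (N ∸ I) * sgn I * sgn I   ≡⟨ cong (_* sgn I) (ℤ.^-distribˡ-+-* (- 1ℤ) (N ∸ I) I) ⟨
    sgn (N ∸ I ℕ.+ I) * sgn I     ≡⟨ cong (λ e → sgn e * sgn I) (ℕ.m∸n+n≡m I≤N) ⟩
    sgn N * sgn I                 ≡⟨ cong (_* sgn I) (sgn-odd oddN) ⟩
    -1ℤ * sgn I                   ≡⟨ ℤ.-1*i≡-i (sgn I) ⟩
    - sgn I                       ∎
    where open ≡-Reasoning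

  flip-mod : ∀ {k} (j : Fin k) → toℤ (flip j) ≡ - toℤ j mod k
  flip-mod {suc k} zero = mod-refl
  flip-mod {suc k} (suc j) = begin
    toℤ (flip (suc j))             ≈⟨ toℤ-modFin (suc j) _ ⟩
    + (suc k ∸ suc (toℕ j))        ≡⟨ pos-∸ (Fin.toℕ≤n (suc j)) ⟩
    + suc k + - toℤ (suc j)        ≈⟨ +-cong-mod modulus≡0-mod (mod-refl {a = - toℤ (suc j)}) ⟩
    0ℤ + - toℤ (suc j)             ≡⟨ ℤ.+-identityˡ _ ⟩
    - toℤ (suc j)                  ∎
    where open ≡-mod-Reasoning (suc k)

  toℕ-flip-suc : ∀ {k} (j : Fin k) → toℕ (flip (suc j)) ≡ k ∸ toℕ j
  toℕ-flip-suc {k} j = toℕ-modFin (suc j) (s≤s (ℕ.m∸n≤m k (toℕ j))) mod-refl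

  toℤ-cyc : ∀ {k} (i : Fin k) → toℤ (cyc i) ≡ + suc (toℕ i) mod k
  toℤ-cyc i = mod-trans (toℤ-modFin i _)
    (mod-reflexive (trans (sym (ℤ.pos-+ (toℕ i) 1)) (cong +_ (ℕ.+-comm (toℕ i) 1))))

  toℕ-cyc-< : ∀ {k} (i : Fin k) → suc (toℕ i) < k → toℕ (cyc i) ≡ suc (toℕ i)
  toℕ-cyc-< i lt = residue-unique (Fin.toℕ<n (cyc i)) lt (toℤ-cyc i)

  toℕ-cyc-last : ∀ {k} (i : Fin k) → suc (toℕ i) ≡ k → toℕ (cyc i) ≡ 0
  toℕ-cyc-last {k} i last = residue-unique (Fin.toℕ<n (cyc i)) (subst (0 <_) last (s≤s z≤n))
    (mod-trans (toℤ-cyc i) (subst (λ N → + N ≡ 0ℤ mod k) (sym last) modulus≡0-mod))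

  σ₁-last : ∀ {N m} (i : Fin N) (j : Fin m) → suc (toℕ i) ≡ N → σ₁ N m (i , j) ≡ (cyc i , cpow -1ℤ (flip j))
  σ₁-last i j last = cong (λ b → cyc i , (if b then flip ⨾ cpow -1ℤ else id) j) (dec-true (_ ℕ.≟ _) last)

  σ₁-not-last : ∀ {N m} (i : Fin N) (j : Fin m) → suc (toℕ i) ≢ N → σ₁ N m (i , j) ≡ (cyc i , j)
  σ₁-not-last i j ¬last = cong (λ b → cyc i , (if b then flip ⨾ cpow -1ℤ else id) j) (dec-false (_ ℕ.≟ _) ¬last)

  twist : ∀ {n m} → V n m → ℤ
  twist (i , j) = sgn (toℕ i) * (+ 2 * toℤ j + 1ℤ)

  odd-cong-mod : ∀ {m} s {a b} → a ≡ b mod m → s * (+ 2 * a + 1ℤ) ≡ s * (+ 2 * b + 1ℤ) mod m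
  odd-cong-mod s p = *-congˡ-mod s (+-cong-mod (*-congˡ-mod (+ 2) p) mod-refl)

  twist-σ₁ : ∀ {N} m → Odd N → (v : V N m) → twist (σ₁ N m v) ≡ - twist v mod m
  twist-σ₁ {N} m (q , N≡1+2q) (i , j) with suc (toℕ i) ℕ.≟ N
  ... | yes last = begin
    twist (σ₁ N m (i , j))
      ≡⟨ cong twist (σ₁-last i j last) ⟩
    sgn (toℕ (cyc i)) * (+ 2 * toℤ (cpow -1ℤ (flip j)) + 1ℤ)
      ≡⟨ cong (λ e → sgn e * (+ 2 * toℤ (cpow -1ℤ (flip j)) + 1ℤ)) (toℕ-cyc-last i last) ⟩
    1ℤ * (+ 2 * toℤ (cpow -1ℤ (flip j)) + 1ℤ)
      ≈⟨ odd-cong-mod 1ℤ (mod-trans (toℤ-modFin (flip j) _) (+-cong-mod (flip-mod j) mod-refl)) ⟩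
    1ℤ * (+ 2 * (- toℤ j + -1ℤ) + 1ℤ)
      ≡⟨ ring (toℤ j) ⟩
    - (1ℤ * (+ 2 * toℤ j + 1ℤ))
      ≡⟨ cong (λ e → - (e * (+ 2 * toℤ j + 1ℤ))) sgn-i ⟨
    - (sgn (toℕ i) * (+ 2 * toℤ j + 1ℤ)) ∎
    where
    open ≡-mod-Reasoning m
    ring : ∀ J → 1ℤ * (+ 2 * (- J + -1ℤ) + 1ℤ) ≡ - (1ℤ * (+ 2 * J + 1ℤ))
    ring = solve-∀
    sgn-i : sgn (toℕ i) ≡ 1ℤ
    sgn-i = trans (cong sgn (ℕ.suc-injective (trans last N≡1+2q))) (sgn-even q)
  ... | no ¬last = mod-reflexive (begin
    twist (σ₁ N m (i , j))
      ≡⟨ cong twist (σ₁-not-last i j ¬last) ⟩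
    sgn (toℕ (cyc i)) * (+ 2 * toℤ j + 1ℤ)
      ≡⟨ cong (λ e → sgn e * (+ 2 * toℤ j + 1ℤ)) (toℕ-cyc-< i (ℕ.≤∧≢⇒< (Fin.toℕ<n i) ¬last)) ⟩
    sgn (suc (toℕ i)) * (+ 2 * toℤ j + 1ℤ)
      ≡⟨ cong (_* (+ 2 * toℤ j + 1ℤ)) (sgn-suc (toℕ i)) ⟩
    - sgn (toℕ i) * (+ 2 * toℤ j + 1ℤ)
      ≡⟨ ℤ.neg-distribˡ-* (sgn (toℕ i)) (+ 2 * toℤ j + 1ℤ) ⟨
    - (sgn (toℕ i) * (+ 2 * toℤ j + 1ℤ)) ∎)
    where open ≡-Reasoning

  twist-σ₂ : ∀ {N} m → Odd N → (v : V N m) →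
             twist (σ₂ N m v) ≡ - twist v - + 4 * toℤ (proj₁ v) + + 2 mod m
  twist-σ₂ {suc k} m oddN (zero , j) = begin
    1ℤ * (+ 2 * toℤ (flip j) + 1ℤ)         ≈⟨ odd-cong-mod 1ℤ (flip-mod j) ⟩
    1ℤ * (+ 2 * - toℤ j + 1ℤ)              ≡⟨ ring (toℤ j) ⟩
    - (1ℤ * (+ 2 * toℤ j + 1ℤ)) - + 4 * 0ℤ + + 2 ∎
    where
    open ≡-mod-Reasoning m
    ring : ∀ J → 1ℤ * (+ 2 * - J + 1ℤ) ≡ - (1ℤ * (+ 2 * J + 1ℤ)) - + 4 * 0ℤ + + 2
    ring = solve-∀
  twist-σ₂ {suc k} m oddN (suc i , j) = begin
    sgn (toℕ (flip (suc i))) * (+ 2 * toℤ (cpow E j) + 1ℤ)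
      ≡⟨ cong (λ e → sgn e * (+ 2 * toℤ (cpow E j) + 1ℤ)) (toℕ-flip-suc i) ⟩
    sgn (k ∸ toℕ i) * (+ 2 * toℤ (cpow E j) + 1ℤ)
      ≡⟨ cong (_* (+ 2 * toℤ (cpow E j) + 1ℤ)) (sgn-odd-∸ oddN (Fin.toℕ≤n (suc i))) ⟩
    - S * (+ 2 * toℤ (cpow E j) + 1ℤ)
      ≈⟨ odd-cong-mod (- S) (toℤ-modFin j _) ⟩
    - S * (+ 2 * (Y + S * (+ 2 * (1ℤ + I) - + 3)) + 1ℤ)
      ≡⟨ ring S Y I ⟩
    - (S * (+ 2 * Y + 1ℤ)) - (S * S) * (+ 4 * I - + 2)
      ≡⟨ cong (λ e → - (S * (+ 2 * Y + 1ℤ)) - e * (+ 4 * I - + 2)) (sgn*sgn (suc (toℕ i))) ⟩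
    - (S * (+ 2 * Y + 1ℤ)) - 1ℤ * (+ 4 * I - + 2)
      ≡⟨ ring₁ (S * (+ 2 * Y + 1ℤ)) I ⟩
    - (S * (+ 2 * Y + 1ℤ)) - + 4 * I + + 2 ∎
    where
    open ≡-mod-Reasoning m
    S Y I E : ℤ
    S = sgn (suc (toℕ i))
    Y = toℤ j
    I = toℤ (suc i)
    E = S * (+ (2 ℕ.* suc (suc (toℕ i))) - + 3)
    ring : ∀ S Y I → - S * (+ 2 * (Y + S * (+ 2 * (1ℤ + I) - + 3)) + 1ℤ)
                     ≡ - (S * (+ 2 * Y + 1ℤ)) - (S * S) * (+ 4 * I - + 2)
    ring = solve-∀
    ring₁ : ∀ T I → - T - 1ℤ * (+ 4 * I - + 2) ≡ - T - + 4 * I + + 2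
    ring₁ = solve-∀

  -- The affine group

  signℤ : Sign → ℤ
  signℤ s = s ◃ 1

  signℤ-* : ∀ s t → signℤ (s Sign.* t) ≡ signℤ s * signℤ t
  signℤ-* Sign.+ Sign.+ = refl
  signℤ-* Sign.+ Sign.- = refl
  signℤ-* Sign.- Sign.+ = refl
  signℤ-* Sign.- Sign.- = refl

  signℤ*signℤ : ∀ s → signℤ s * signℤ s ≡ 1ℤ
  signℤ*signℤ Sign.+ = refl
  signℤ*signℤ Sign.- = refl

  2≢0-mod : ∀ {k} → 2 < k → ¬ (+ 2 ≡ 0ℤ mod k)
  2≢0-mod 2<k 2≡0 with residue-unique 2<k (ℕ.≤-trans (s≤s z≤n) 2<k) 2≡0
  ... | ()

  signℤ-injective-mod : ∀ {k s t} → 2 < k → signℤ s ≡ signℤ t mod k → s ≡ t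
  signℤ-injective-mod {s = Sign.+} {Sign.+} _ _ = refl
  signℤ-injective-mod {s = Sign.-} {Sign.-} _ _ = refl
  signℤ-injective-mod {s = Sign.+} {Sign.-} 2<k p = contradiction (+-cong-mod p (mod-refl {a = 1ℤ})) (2≢0-mod 2<k)
  signℤ-injective-mod {s = Sign.-} {Sign.+} 2<k p =
    contradiction (mod-sym (+-cong-mod p (mod-refl {a = 1ℤ}))) (2≢0-mod 2<k)

  record Affine : Set where
    constructor affine
    field
      ε : Sign
      b : ℤ
      δ : Sign
      l : ℤ
      u : ℤ

  eval₁ : Affine → ℤ → ℤ
  eval₁ (affine ε b δ l u) I = signℤ ε * I + b

  eval₂ : Affine → ℤ → ℤ → ℤ
  eval₂ (affine ε b δ l u) I Y = signℤ δ * Y + l * I + u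

  infixl 7 _·_
  _·_ : Affine → Affine → Affine
  affine ε b δ l u · affine ε′ b′ δ′ l′ u′ =
    affine (ε Sign.* ε′) (signℤ ε′ * b + b′)
           (δ Sign.* δ′) (signℤ δ′ * l + l′ * signℤ ε) (signℤ δ′ * u + l′ * b + u′)

  1A : Affine
  1A = affine Sign.+ 0ℤ Sign.+ 0ℤ 0ℤ

  infix 8 _⁻¹
  _⁻¹ : Affine → Affine
  affine ε b δ l u ⁻¹ =
    affine ε (- (signℤ ε * b)) δ (- (signℤ δ * signℤ ε * l)) (signℤ δ * signℤ ε * l * b - signℤ δ * u)

  infixr 8 _^_
  _^_ : Affine → ℕ → Affine
  d ^ zero = 1A
  d ^ suc k = d ^ k · d

  infix 8 _^ˢ_
  _^ˢ_ : Affine → Sign → Affine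
  d ^ˢ Sign.+ = 1A
  d ^ˢ Sign.- = d

  alt : ℕ → Sign
  alt zero = Sign.+
  alt (suc k) = alt k Sign.* Sign.-

  alt-even : ∀ q → alt (2 ℕ.* q) ≡ Sign.+
  alt-even zero = refl
  alt-even (suc q) = begin
    alt (2 ℕ.* suc q)                  ≡⟨ cong alt (cong suc (ℕ.+-suc q (q ℕ.+ 0))) ⟩
    alt (2 ℕ.* q) Sign.* Sign.- Sign.* Sign.- ≡⟨ cong (λ s → s Sign.* Sign.- Sign.* Sign.-) (alt-even q) ⟩
    Sign.+                             ∎
    where open ≡-Reasoning

  alt-odd : ∀ {k} → Odd k → alt k ≡ Sign.-
  alt-odd (q , refl) = cong (Sign._* Sign.-) (alt-even q)

  module AffineAction (s m : ℕ) where

    n : ℕ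
    n = s ℕ.* m

    infix 4 _∼_
    record _∼_ (d d′ : Affine) : Set where
      field
        ε-eq : Affine.ε d ≡ Affine.ε d′
        b-eq : Affine.b d ≡ Affine.b d′ mod n
        δ-eq : Affine.δ d ≡ Affine.δ d′
        l-eq : Affine.l d ≡ Affine.l d′ mod m
        u-eq : Affine.u d ≡ Affine.u d′ mod m
    open _∼_ public

    ∼-refl : ∀ {d} → d ∼ d
    ∼-refl = record { ε-eq = refl ; b-eq = mod-refl ; δ-eq = refl ; l-eq = mod-refl ; u-eq = mod-refl }

    ∼-sym : ∀ {d d′} → d ∼ d′ → d′ ∼ d
    ∼-sym p = record { ε-eq = sym (ε-eq p) ; b-eq = mod-sym (b-eq p) ; δ-eq = sym (δ-eq p)
                     ; l-eq = mod-sym (l-eq p) ; u-eq = mod-sym (u-eq p) }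

    ∼-trans : ∀ {d d′ d″} → d ∼ d′ → d′ ∼ d″ → d ∼ d″
    ∼-trans p q = record { ε-eq = trans (ε-eq p) (ε-eq q) ; b-eq = mod-trans (b-eq p) (b-eq q)
                         ; δ-eq = trans (δ-eq p) (δ-eq q) ; l-eq = mod-trans (l-eq p) (l-eq q)
                         ; u-eq = mod-trans (u-eq p) (u-eq q) }

    ∼-reflexive : ∀ {ε δ b b′ l l′ u u′} → b ≡ b′ → l ≡ l′ → u ≡ u′ → affine ε b δ l u ∼ affine ε b′ δ l′ u′
    ∼-reflexive b≡b′ l≡l′ u≡u′ = record { ε-eq = refl ; b-eq = mod-reflexive b≡b′ ; δ-eq = refl
                                        ; l-eq = mod-reflexive l≡l′ ; u-eq = mod-reflexive u≡u′ }

    ·-cong : ∀ {d₁ d₂ d₁′ d₂′} → d₁ ∼ d₂ → d₁′ ∼ d₂′ → d₁ · d₁′ ∼ d₂ · d₂′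
    ·-cong {affine ε _ δ _ _} {affine _ _ _ _ _} {affine ε′ _ δ′ _ _} {affine _ _ _ _ _}
      record { ε-eq = refl ; b-eq = b₁ ; δ-eq = refl ; l-eq = l₁ ; u-eq = u₁ }
      record { ε-eq = refl ; b-eq = b₂ ; δ-eq = refl ; l-eq = l₂ ; u-eq = u₂ } = record
      { ε-eq = refl
      ; b-eq = +-cong-mod (*-congˡ-mod (signℤ ε′) b₁) b₂
      ; δ-eq = refl
      ; l-eq = +-cong-mod (*-congˡ-mod (signℤ δ′) l₁) (*-cong-mod l₂ mod-refl)
      ; u-eq = +-cong-mod (+-cong-mod (*-congˡ-mod (signℤ δ′) u₁) (*-cong-mod l₂ (mod-weaken s b₁))) u₂
      }

    ⁻¹-cong : ∀ {d d′} → d ∼ d′ → d ⁻¹ ∼ d′ ⁻¹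
    ⁻¹-cong {affine ε _ δ _ _} {affine _ _ _ _ _}
      record { ε-eq = refl ; b-eq = b₁ ; δ-eq = refl ; l-eq = l₁ ; u-eq = u₁ } = record
      { ε-eq = refl
      ; b-eq = neg-cong-mod (*-congˡ-mod (signℤ ε) b₁)
      ; δ-eq = refl
      ; l-eq = neg-cong-mod (*-congˡ-mod (signℤ δ * signℤ ε) l₁)
      ; u-eq = +-cong-mod (*-cong-mod (*-congˡ-mod (signℤ δ * signℤ ε) l₁) (mod-weaken s b₁))
                          (neg-cong-mod (*-congˡ-mod (signℤ δ) u₁))
      }

    private
      vanishes : ∀ {a} s P → a ≡ (1ℤ - signℤ s * signℤ s) * P → a ≡ 0ℤ
      vanishes s P a≡ = trans a≡ (trans (cong (λ e → (1ℤ - e) * P) (signℤ*signℤ s)) (ℤ.*-zeroˡ P))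

    inverseˡ : ∀ d → d ⁻¹ · d ∼ 1A
    inverseˡ (affine ε b δ l u) = record
      { ε-eq = Sign.s*s≡+ ε
      ; b-eq = mod-reflexive (vanishes ε b (ring-b (signℤ ε) b))
      ; δ-eq = Sign.s*s≡+ δ
      ; l-eq = mod-reflexive (vanishes δ (signℤ ε * l) (ring-l (signℤ ε) (signℤ δ) l))
      ; u-eq = mod-reflexive (vanishes δ (u - signℤ ε * l * b) (ring-u (signℤ ε) (signℤ δ) l b u))
      }
      where
      ring-b : ∀ x b → x * - (x * b) + b ≡ (1ℤ - x * x) * b
      ring-b = solve-∀
      ring-l : ∀ x y l → y * - (y * x * l) + l * x ≡ (1ℤ - y * y) * (x * l)
      ring-l = solve-∀
      ring-u : ∀ x y l b u → y * (y * x * l * b - y * u) + l * - (x * b) + u ≡ (1ℤ - y * y) * (u - x * l * b)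
      ring-u = solve-∀

    inverseʳ : ∀ d → d · d ⁻¹ ∼ 1A
    inverseʳ (affine ε b δ l u) = record
      { ε-eq = Sign.s*s≡+ ε
      ; b-eq = mod-reflexive (ring-b (signℤ ε) b)
      ; δ-eq = Sign.s*s≡+ δ
      ; l-eq = mod-reflexive (vanishes ε (signℤ δ * l) (ring-l (signℤ ε) (signℤ δ) l))
      ; u-eq = mod-reflexive (ring-u (signℤ ε) (signℤ δ) l b u)
      }
      where
      ring-b : ∀ x b → x * b + - (x * b) ≡ 0ℤ
      ring-b = solve-∀
      ring-l : ∀ x y l → y * l + - (y * x * l) * x ≡ (1ℤ - x * x) * (y * l)
      ring-l = solve-∀
      ring-u : ∀ x y l b u → y * u + - (y * x * l) * b + (y * x * l * b - y * u) ≡ 0ℤ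
      ring-u = solve-∀

    ^-cong : ∀ {d d′} k → d ∼ d′ → d ^ k ∼ d′ ^ k
    ^-cong zero    d∼d′ = ∼-refl
    ^-cong (suc k) d∼d′ = ·-cong (^-cong k d∼d′) d∼d′

    ∼-setoid : Setoid _ _
    ∼-setoid = record
      { Carrier = Affine ; _≈_ = _∼_
      ; isEquivalence = record { refl = ∼-refl ; sym = ∼-sym ; trans = ∼-trans } }

    ·-positive : ∀ ε b δ l u b′ l′ u′ {b″ l″ u″} →
                 b + b′ ≡ b″ → l + l′ * signℤ ε ≡ l″ → u + l′ * b + u′ ≡ u″ →
                 affine ε b δ l u · affine Sign.+ b′ Sign.+ l′ u′ ∼ affine ε b″ δ l″ u″
    ·-positive ε b δ l u b′ l′ u′ b≡ l≡ u≡ = record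
      { ε-eq = Sign.*-identityʳ ε ; b-eq = mod-reflexive (trans (cong (_+ b′) (ℤ.*-identityˡ b)) b≡)
      ; δ-eq = Sign.*-identityʳ δ ; l-eq = mod-reflexive (trans (cong (_+ l′ * signℤ ε) (ℤ.*-identityˡ l)) l≡)
      ; u-eq = mod-reflexive (trans (cong (λ e → e + l′ * b + u′) (ℤ.*-identityˡ u)) u≡) }

    ·-congʳ : ∀ {d₁ d₂} d → d₁ ∼ d₂ → d₁ · d ∼ d₂ · d
    ·-congʳ d d₁∼d₂ = ·-cong d₁∼d₂ (∼-refl {d})

    normal-form : ∀ ε B δ L U →
      affine Sign.+ 0ℤ δ 0ℤ 0ℤ · affine Sign.+ 0ℤ Sign.+ L 0ℤ · affine Sign.+ 0ℤ Sign.+ 0ℤ U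
        · affine ε 0ℤ Sign.+ 0ℤ 0ℤ · affine Sign.+ B Sign.+ 0ℤ 0ℤ ∼ affine ε B δ L U
    normal-form ε B δ L U = begin
      affine Sign.+ 0ℤ δ 0ℤ 0ℤ · affine Sign.+ 0ℤ Sign.+ L 0ℤ · lift-U · flip-ε · shift-B
        ≈⟨ ·-congʳ shift-B (·-congʳ flip-ε (·-congʳ lift-U
             (·-positive Sign.+ 0ℤ δ 0ℤ 0ℤ 0ℤ L 0ℤ refl (ring₁ L) (ring₂ L)))) ⟩
      affine Sign.+ 0ℤ δ L 0ℤ · lift-U · flip-ε · shift-B
        ≈⟨ ·-congʳ shift-B (·-congʳ flip-ε
             (·-positive Sign.+ 0ℤ δ L 0ℤ 0ℤ 0ℤ U refl (ring₃ L) (ring₄ U))) ⟩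
      affine Sign.+ 0ℤ δ L U · flip-ε · shift-B
        ≈⟨ ·-congʳ shift-B flip-step ⟩
      affine ε 0ℤ δ L U · shift-B
        ≈⟨ ·-positive ε 0ℤ δ L U B 0ℤ 0ℤ (ℤ.+-identityˡ B) (ring₅ L (signℤ ε)) (ring₆ U) ⟩
      affine ε B δ L U ∎
      where
      open SetoidReasoning ∼-setoid
      lift-U flip-ε shift-B : Affine
      lift-U = affine Sign.+ 0ℤ Sign.+ 0ℤ U
      flip-ε = affine ε 0ℤ Sign.+ 0ℤ 0ℤ
      shift-B = affine Sign.+ B Sign.+ 0ℤ 0ℤ
      ring₁ : ∀ L → 0ℤ + L * 1ℤ ≡ L
      ring₁ = solve-∀
      ring₂ : ∀ L → 0ℤ + L * 0ℤ + 0ℤ ≡ 0ℤ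
      ring₂ = solve-∀
      ring₃ : ∀ L → L + 0ℤ * 1ℤ ≡ L
      ring₃ = solve-∀
      ring₄ : ∀ U → 0ℤ + 0ℤ * 0ℤ + U ≡ U
      ring₄ = solve-∀
      ring₅ : ∀ L x → L + 0ℤ * x ≡ L
      ring₅ = solve-∀
      ring₆ : ∀ U → U + 0ℤ * 0ℤ + 0ℤ ≡ U
      ring₆ = solve-∀
      flip-step : affine Sign.+ 0ℤ δ L U · affine ε 0ℤ Sign.+ 0ℤ 0ℤ ∼ affine ε 0ℤ δ L U
      flip-step = record
        { ε-eq = refl ; b-eq = mod-reflexive (ring₇ (signℤ ε)) ; δ-eq = Sign.*-identityʳ δ
        ; l-eq = mod-reflexive (ring₈ L) ; u-eq = mod-reflexive (ring₉ U) }
        where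
        ring₇ : ∀ x → x * 0ℤ + 0ℤ ≡ 0ℤ
        ring₇ = solve-∀
        ring₈ : ∀ L → 1ℤ * L + 0ℤ * 1ℤ ≡ L
        ring₈ = solve-∀
        ring₉ : ∀ U → 1ℤ * U + 0ℤ * 0ℤ + 0ℤ ≡ U
        ring₉ = solve-∀

    vertical^ : ∀ c k → affine Sign.+ 0ℤ Sign.+ 0ℤ c ^ k ∼ affine Sign.+ 0ℤ Sign.+ 0ℤ (+ k * c)
    vertical^ c zero    = ∼-refl
    vertical^ c (suc k) = ∼-trans (·-congʳ (affine Sign.+ 0ℤ Sign.+ 0ℤ c) (vertical^ c k))
                                  (∼-reflexive refl refl (ring (+ k) c))
      where ring : ∀ K c → 1ℤ * (K * c) + 0ℤ * 0ℤ + c ≡ (1ℤ + K) * c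
            ring = solve-∀

    horizontal^ : ∀ k → affine Sign.+ 1ℤ Sign.+ 0ℤ 0ℤ ^ k ∼ affine Sign.+ (+ k) Sign.+ 0ℤ 0ℤ
    horizontal^ zero    = ∼-refl
    horizontal^ (suc k) = ∼-trans (·-congʳ (affine Sign.+ 1ℤ Sign.+ 0ℤ 0ℤ) (horizontal^ k))
                                  (∼-reflexive (ring (+ k)) refl refl)
      where ring : ∀ K → 1ℤ * K + 1ℤ ≡ 1ℤ + K
            ring = solve-∀

    act : Affine → V n m → V n m
    act d (i , y) = modFin i (eval₁ d (toℤ i)) , modFin y (eval₂ d (toℤ i) (toℤ y))

    act-· : ∀ d d′ → (act d ⨾ act d′) ≈ act (d · d′)
    act-· (affine ε b δ l u) (affine ε′ b′ δ′ l′ u′) (i , y) = cong₂ _,_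
      (modFin-cong _ i (let open ≡-mod-Reasoning n in begin
        signℤ ε′ * toℤ (modFin i (signℤ ε * I + b)) + b′
          ≈⟨ +-cong-mod (*-congˡ-mod (signℤ ε′) (toℤ-modFin i _)) (mod-refl {a = b′}) ⟩
        signℤ ε′ * (signℤ ε * I + b) + b′
          ≡⟨ ring₁ (signℤ ε) (signℤ ε′) I b b′ ⟩
        signℤ ε * signℤ ε′ * I + (signℤ ε′ * b + b′)
          ≡⟨ cong (λ e → e * I + (signℤ ε′ * b + b′)) (signℤ-* ε ε′) ⟨
        signℤ (ε Sign.* ε′) * I + (signℤ ε′ * b + b′) ∎))
      (modFin-cong _ y (let open ≡-mod-Reasoning m in begin
        signℤ δ′ * toℤ (modFin y (signℤ δ * Y + l * I + u)) + l′ * toℤ (modFin i (signℤ ε * I + b)) + u′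
          ≈⟨ +-cong-mod (+-cong-mod (*-congˡ-mod (signℤ δ′) (toℤ-modFin y _))
                                    (*-congˡ-mod l′ (mod-weaken s (toℤ-modFin i _))))
                        (mod-refl {a = u′}) ⟩
        signℤ δ′ * (signℤ δ * Y + l * I + u) + l′ * (signℤ ε * I + b) + u′
          ≡⟨ ring₂ (signℤ δ) (signℤ δ′) (signℤ ε) Y I l u l′ b u′ ⟩
        signℤ δ * signℤ δ′ * Y + (signℤ δ′ * l + l′ * signℤ ε) * I + (signℤ δ′ * u + l′ * b + u′)
          ≡⟨ cong (λ e → e * Y + (signℤ δ′ * l + l′ * signℤ ε) * I + (signℤ δ′ * u + l′ * b + u′))
                  (signℤ-* δ δ′) ⟨
        signℤ (δ Sign.* δ′) * Y + (signℤ δ′ * l + l′ * signℤ ε) * I + (signℤ δ′ * u + l′ * b + u′) ∎))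
      where
      I Y : ℤ
      I = toℤ i
      Y = toℤ y
      ring₁ : ∀ x x′ I b b′ → x′ * (x * I + b) + b′ ≡ x * x′ * I + (x′ * b + b′)
      ring₁ = solve-∀
      ring₂ : ∀ x x′ z Y I l u l′ b u′ → x′ * (x * Y + l * I + u) + l′ * (z * I + b) + u′
                                        ≡ x * x′ * Y + (x′ * l + l′ * z) * I + (x′ * u + l′ * b + u′)
      ring₂ = solve-∀

    act-cong : ∀ {d d′} → d ∼ d′ → act d ≈ act d′
    act-cong {affine ε _ δ _ _} {affine _ _ _ _ _}
      record { ε-eq = refl ; b-eq = b≡ ; δ-eq = refl ; l-eq = l≡ ; u-eq = u≡ } (i , y) =
      cong₂ _,_ (modFin-cong i i (+-cong-mod (mod-refl {a = signℤ ε * toℤ i}) b≡))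
                (modFin-cong y y (+-cong-mod (+-cong-mod (mod-refl {a = signℤ δ * toℤ y}) (*-cong-mod l≡ mod-refl)) u≡))

    act-1A : act 1A ≈ id
    act-1A (i , y) = cong₂ _,_ (modFin-unique i (mod-reflexive (ring₁ (toℤ i))))
                               (modFin-unique y (mod-reflexive (ring₂ (toℤ i) (toℤ y))))
      where
      ring₁ : ∀ I → 1ℤ * I + 0ℤ ≡ I
      ring₁ = solve-∀
      ring₂ : ∀ I Y → 1ℤ * Y + 0ℤ * I + 0ℤ ≡ Y
      ring₂ = solve-∀

    -- The images of (0 , 0), (1 , 0) and (0 , 1) determine b and u, then ε, l and δ; a modulus above 2
    -- keeps the signs 1 and -1 apart.
    act-injective : 2 < n → 2 < m → ∀ d d′ → act d ≈ act d′ → d ∼ d′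
    act-injective 2<n 2<m d@(affine ε b δ l u) d′@(affine ε′ b′ δ′ l′ u′) act≈ = record
      { ε-eq = signℤ-injective-mod 2<n
                 (+-cancelʳ-mod (agree₁ (at 1<n) (ring₁ (signℤ ε) b) (ring₁ (signℤ ε′) b′)) b≡)
      ; b-eq = b≡
      ; δ-eq = signℤ-injective-mod 2<m
                 (+-cancelʳ-mod (agree₂ (at 0<n) (at 1<m) (ring₀₁ (signℤ δ) l u) (ring₀₁ (signℤ δ′) l′ u′)) u≡)
      ; l-eq = +-cancelʳ-mod (agree₂ (at 1<n) (at 0<m) (ring₁₀ (signℤ δ) l u) (ring₁₀ (signℤ δ′) l′ u′)) u≡
      ; u-eq = u≡
      }
      where
      0<n : 0 < n
      0<n = ℕ.≤-trans (s≤s z≤n) 2<n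
      1<n : 1 < n
      1<n = ℕ.≤-trans (s≤s (s≤s z≤n)) 2<n
      0<m : 0 < m
      0<m = ℕ.≤-trans (s≤s z≤n) 2<m
      1<m : 1 < m
      1<m = ℕ.≤-trans (s≤s (s≤s z≤n)) 2<m
      at : ∀ {k r} (r<k : r < k) → Σ (Fin k) λ x → toℤ x ≡ + r
      at r<k = fromℕ< r<k , toℤ-fromℕ< r<k
      agree₁ : ∀ {I a a′} → Σ (Fin n) (λ x → toℤ x ≡ I) → eval₁ d I ≡ a → eval₁ d′ I ≡ a′ → a ≡ a′ mod n
      agree₁ (i , refl) refl refl = modFin-injective i i (cong proj₁ (act≈ (i , fromℕ< 0<m)))
      agree₂ : ∀ {I Y a a′} → Σ (Fin n) (λ x → toℤ x ≡ I) → Σ (Fin m) (λ x → toℤ x ≡ Y) →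
               eval₂ d I Y ≡ a → eval₂ d′ I Y ≡ a′ → a ≡ a′ mod m
      agree₂ (i , refl) (y , refl) refl refl = modFin-injective y y (cong proj₂ (act≈ (i , y)))
      ring₀ : ∀ x b → x * + 0 + b ≡ b
      ring₀ = solve-∀
      ring₁ : ∀ x b → x * + 1 + b ≡ x + b
      ring₁ = solve-∀
      ring₀₀ : ∀ x l u → x * + 0 + l * + 0 + u ≡ u
      ring₀₀ = solve-∀
      ring₀₁ : ∀ x l u → x * + 1 + l * + 0 + u ≡ x + u
      ring₀₁ = solve-∀
      ring₁₀ : ∀ x l u → x * + 0 + l * + 1 + u ≡ l + u
      ring₁₀ = solve-∀
      b≡ : b ≡ b′ mod n
      b≡ = agree₁ (at 0<n) (ring₀ (signℤ ε) b) (ring₀ (signℤ ε′) b′)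
      u≡ : u ≡ u′ mod m
      u≡ = agree₂ (at 0<n) (at 0<m) (ring₀₀ (signℤ δ) l u) (ring₀₀ (signℤ δ′) l′ u′)

  module Realisation (s m h : ℕ) (half : + 2 * + h ≡ 1ℤ mod m) where

    open AffineAction s m public

    twisted : V n m → V n m
    twisted (i , j) = i , modFin j (twist (i , j))

    untwisted : V n m → V n m
    untwisted (i , y) = i , modFin y (+ h * (sgn (toℕ i) * toℤ y - 1ℤ))

    untwisted-twisted : ∀ v → untwisted (twisted v) ≡ v
    untwisted-twisted (i , j) = cong (i ,_) (modFin-unique _ (begin
      + h * (S * toℤ (modFin j (S * X)) - 1ℤ)
        ≈⟨ *-congˡ-mod (+ h) (+-cong-mod (*-congˡ-mod S (toℤ-modFin j _)) (mod-refl {a = - 1ℤ})) ⟩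
      + h * (S * (S * X) - 1ℤ)      ≡⟨ cong (λ e → + h * (e - 1ℤ)) (ℤ.*-assoc S S X) ⟨
      + h * (S * S * X - 1ℤ)        ≡⟨ cong (λ e → + h * (e * X - 1ℤ)) (sgn*sgn (toℕ i)) ⟩
      + h * (1ℤ * X - 1ℤ)           ≡⟨ ring (+ h) (toℤ j) ⟩
      + 2 * + h * toℤ j             ≈⟨ *-cong-mod half (mod-refl {a = toℤ j}) ⟩
      1ℤ * toℤ j                    ≡⟨ ℤ.*-identityˡ (toℤ j) ⟩
      toℤ j                         ∎))
      where
      open ≡-mod-Reasoning m
      S X : ℤ
      S = sgn (toℕ i)
      X = + 2 * toℤ j + 1ℤ
      ring : ∀ H J → H * (1ℤ * (+ 2 * J + 1ℤ) - 1ℤ) ≡ + 2 * H * J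
      ring = solve-∀

    twisted-untwisted : ∀ v → twisted (untwisted v) ≡ v
    twisted-untwisted (i , y) = cong (i ,_) (modFin-unique _ (begin
      S * (+ 2 * toℤ (modFin y Z) + 1ℤ)   ≈⟨ odd-cong-mod S (toℤ-modFin y Z) ⟩
      S * (+ 2 * Z + 1ℤ)                  ≡⟨ cong (λ e → S * (e + 1ℤ)) (ℤ.*-assoc (+ 2) (+ h) _) ⟨
      S * (+ 2 * + h * (S * Y - 1ℤ) + 1ℤ)
        ≈⟨ *-congˡ-mod S (+-cong-mod (*-cong-mod half (mod-refl {a = S * Y - 1ℤ})) (mod-refl {a = 1ℤ})) ⟩
      S * (1ℤ * (S * Y - 1ℤ) + 1ℤ)        ≡⟨ ring S Y ⟩
      S * S * Y                           ≡⟨ cong (_* Y) (sgn*sgn (toℕ i)) ⟩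
      1ℤ * Y                              ≡⟨ ℤ.*-identityˡ Y ⟩
      Y                                   ∎))
      where
      open ≡-mod-Reasoning m
      S Y Z : ℤ
      S = sgn (toℕ i)
      Y = toℤ y
      Z = + h * (S * Y - 1ℤ)
      ring : ∀ S Y → S * (1ℤ * (S * Y - 1ℤ) + 1ℤ) ≡ S * S * Y
      ring = solve-∀

    ⟦_⟧ : Affine → V n m → V n m
    ⟦ d ⟧ = twisted ⨾ act d ⨾ untwisted

    ⟦⟧-· : ∀ d d′ → (⟦ d ⟧ ⨾ ⟦ d′ ⟧) ≈ ⟦ d · d′ ⟧
    ⟦⟧-· d d′ v = cong untwisted (begin
      act d′ (twisted (untwisted (act d (twisted v)))) ≡⟨ cong (act d′) (twisted-untwisted _) ⟩
      act d′ (act d (twisted v))                       ≡⟨ act-· d d′ (twisted v) ⟩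
      act (d · d′) (twisted v)                         ∎)
      where open ≡-Reasoning

    ⟦1A⟧ : ⟦ 1A ⟧ ≈ id
    ⟦1A⟧ v = trans (cong untwisted (act-1A (twisted v))) (untwisted-twisted v)

    ⟦⟧-cong : ∀ {d d′} → d ∼ d′ → ⟦ d ⟧ ≈ ⟦ d′ ⟧
    ⟦⟧-cong d∼d′ v = cong untwisted (act-cong d∼d′ (twisted v))

    ⟦⟧-injective : 2 < n → 2 < m → ∀ d d′ → ⟦ d ⟧ ≈ ⟦ d′ ⟧ → d ∼ d′
    ⟦⟧-injective 2<n 2<m d d′ ⟦d⟧≈⟦d′⟧ = act-injective 2<n 2<m d d′ λ w → begin
      act d w                                       ≡⟨ cong (act d) (twisted-untwisted w) ⟨
      act d (twisted (untwisted w))                 ≡⟨ twisted-untwisted _ ⟨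
      twisted (⟦ d ⟧ (untwisted w))                 ≡⟨ cong twisted (⟦d⟧≈⟦d′⟧ (untwisted w)) ⟩
      twisted (⟦ d′ ⟧ (untwisted w))                ≡⟨ twisted-untwisted _ ⟩
      act d′ (twisted (untwisted w))                ≡⟨ cong (act d′) (twisted-untwisted w) ⟩
      act d′ w                                      ∎
      where open ≡-Reasoning

    ⟦⟧-intertwines : ∀ {f} d → (∀ v → twisted (f v) ≡ act d (twisted v)) → f ≈ ⟦ d ⟧
    ⟦⟧-intertwines {f} d comm v = trans (sym (untwisted-twisted (f v))) (cong untwisted (comm v))

    g₁ g₂ : Affine
    g₁ = affine Sign.+ 1ℤ Sign.- 0ℤ 0ℤ
    g₂ = affine Sign.- 0ℤ Sign.- (- + 4) (+ 2)

    σ₁≈⟦g₁⟧ : Odd n → σ₁ n m ≈ ⟦ g₁ ⟧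
    σ₁≈⟦g₁⟧ odd-n = ⟦⟧-intertwines g₁ commutes
      where
      commutes : ∀ v → twisted (σ₁ n m v) ≡ act g₁ (twisted v)
      commutes (i , j) = cong₂ _,_
        (modFin-cong i i (mod-reflexive (sym (ring₁ (toℤ i)))))
        (modFin-cong _ _ (mod-trans (twist-σ₁ m odd-n (i , j))
          (mod-trans (neg-cong-mod (mod-sym (toℤ-modFin j (twist (i , j)))))
            (mod-reflexive (sym (ring₂ (toℤ (modFin j (twist (i , j)))) (toℤ i)))))))
        where
        ring₁ : ∀ I → 1ℤ * I + 1ℤ ≡ I + 1ℤ
        ring₁ = solve-∀
        ring₂ : ∀ Y I → -1ℤ * Y + 0ℤ * I + 0ℤ ≡ - Y
        ring₂ = solve-∀

    σ₂≈⟦g₂⟧ : Odd n → σ₂ n m ≈ ⟦ g₂ ⟧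
    σ₂≈⟦g₂⟧ odd-n = ⟦⟧-intertwines g₂ commutes
      where
      commutes : ∀ v → twisted (σ₂ n m v) ≡ act g₂ (twisted v)
      commutes (i , j) = cong₂ _,_
        (sym (modFin-unique i (mod-trans (mod-reflexive (ring₁ (toℤ i))) (mod-sym (flip-mod i)))))
        (modFin-cong _ _ (mod-trans (twist-σ₂ m odd-n (i , j))
          (mod-trans (+-cong-mod (+-cong-mod (neg-cong-mod (mod-sym (toℤ-modFin j (twist (i , j)))))
                                             (mod-refl {a = - (+ 4 * toℤ i)})) (mod-refl {a = + 2}))
            (mod-reflexive (ring₂ (toℤ (modFin j (twist (i , j)))) (toℤ i))))))
        where
        ring₁ : ∀ I → -1ℤ * I + 0ℤ ≡ - I
        ring₁ = solve-∀
        ring₂ : ∀ Y I → - Y - + 4 * I + + 2 ≡ -1ℤ * Y + - + 4 * I + + 2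
        ring₂ = solve-∀

    ⟦⟧-inverseˡ : ∀ d → (⟦ d ⁻¹ ⟧ ⨾ ⟦ d ⟧) ≈ id
    ⟦⟧-inverseˡ d v = trans (⟦⟧-· (d ⁻¹) d v) (trans (⟦⟧-cong (inverseˡ d) v) (⟦1A⟧ v))

    ⟦⟧-inverseʳ : ∀ d → (⟦ d ⟧ ⨾ ⟦ d ⁻¹ ⟧) ≈ id
    ⟦⟧-inverseʳ d v = trans (⟦⟧-· d (d ⁻¹) v) (trans (⟦⟧-cong (inverseʳ d) v) (⟦1A⟧ v))

  -- The subgroup ⟨σ₁ , σ₂⟩

  ⨾-cong : ∀ {A : Set} {f f′ g g′ : A → A} → f ≈ f′ → g ≈ g′ → (f ⨾ g) ≈ (f′ ⨾ g′)
  ⨾-cong {f′ = f′} {g = g} f≈f′ g≈g′ v = trans (cong g (f≈f′ v)) (g≈g′ (f′ v))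

  HasCard-enumeration : ∀ {A R : Set} {P : (A → A) → Set} (rs : List R) → Unique rs → (∀ r → r ∈ rs) →
    (f : R → A → A) → (∀ r → P (f r)) → (∀ r r′ → f r ≈ f r′ → r ≡ r′) →
    (∀ g → P g → Σ R λ r → g ≈ f r) → HasCard P (length rs)
  HasCard-enumeration rs unique complete f f∈P f-injective P⊆f = map f rs
    , List.length-map f rs
    , All.map⁺ (All.universal f∈P rs)
    , AllPairs.map⁺ (AllPairs.map (λ r≢r′ fr≈fr′ → r≢r′ (f-injective _ _ fr≈fr′)) unique)
    , λ g Pg → let r , g≈fr = P⊆f g Pg in Any.map⁺ (Any.map (λ { refl → g≈fr }) (complete r))

  length-cartesianProduct : ∀ {A B : Set} (xs : List A) (ys : List B) →
    length (cartesianProduct xs ys) ≡ length xs ℕ.* length ys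
  length-cartesianProduct []       ys = refl
  length-cartesianProduct (x ∷ xs) ys = trans (List.length-++ (map (x ,_) ys))
    (cong₂ ℕ._+_ (List.length-map (x ,_) ys) (length-cartesianProduct xs ys))

  module Subgroup (s m h : ℕ) (half : + 2 * + h ≡ 1ℤ mod m)
                  (odd-n : Odd (s ℕ.* m)) (2<n : 2 < s ℕ.* m) (2<m : 2 < m) where

    open Realisation s m h half

    pow-⟦⟧ : ∀ {f d} k → f ≈ ⟦ d ⟧ → pow f k ≈ ⟦ d ^ k ⟧
    pow-⟦⟧ zero    f≈⟦d⟧ v = sym (⟦1A⟧ v)
    pow-⟦⟧ {f} {d} (suc k) f≈⟦d⟧ v = trans (⨾-cong (pow-⟦⟧ k f≈⟦d⟧) f≈⟦d⟧ v) (⟦⟧-· (d ^ k) d v)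

    HasOrder-⟦⟧ : ∀ {f d k} → f ≈ ⟦ d ⟧ → 1 ≤ k → d ^ k ∼ 1A →
                  (∀ j → 1 ≤ j → j < k → ¬ d ^ j ∼ 1A) → HasOrder f k
    HasOrder-⟦⟧ {f} {d} {k} f≈⟦d⟧ 1≤k d^k∼1 nontrivial = 1≤k
      , (λ v → trans (pow-⟦⟧ k f≈⟦d⟧ v) (trans (⟦⟧-cong d^k∼1 v) (⟦1A⟧ v)))
      , λ j 1≤j j<k f^j≈id → nontrivial j 1≤j j<k (⟦⟧-injective 2<n 2<m (d ^ j) 1A
          (λ v → trans (sym (pow-⟦⟧ j f≈⟦d⟧ v)) (trans (f^j≈id v) (sym (⟦1A⟧ v)))))

    g₁^ : ∀ k → g₁ ^ k ∼ affine Sign.+ (+ k) (alt k) 0ℤ 0ℤ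
    g₁^ zero    = ∼-refl
    g₁^ (suc k) = ∼-trans (·-congʳ g₁ (g₁^ k)) (∼-reflexive (ring (+ k)) refl refl)
      where ring : ∀ K → 1ℤ * K + 1ℤ ≡ 1ℤ + K
            ring = solve-∀

    g₂^even : ∀ k → g₂ ^ (2 ℕ.* k) ∼ affine Sign.+ 0ℤ Sign.+ (+ 8 * + k) 0ℤ
    g₂^odd  : ∀ k → g₂ ^ suc (2 ℕ.* k) ∼ affine Sign.- 0ℤ Sign.- (- (+ 8 * + k) - + 4) (+ 2)
    g₂^even zero    = ∼-refl
    g₂^even (suc k) = subst (λ e → g₂ ^ e ∼ affine Sign.+ 0ℤ Sign.+ (+ 8 * + suc k) 0ℤ)
                            (cong suc (sym (ℕ.+-suc k (k ℕ.+ 0))))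
      (∼-trans (·-congʳ g₂ (g₂^odd k)) (∼-reflexive refl (ring (+ k)) refl))
      where ring : ∀ K → -1ℤ * (- (+ 8 * K) - + 4) + - + 4 * -1ℤ ≡ + 8 * (1ℤ + K)
            ring = solve-∀
    g₂^odd k = ∼-trans (·-congʳ g₂ (g₂^even k)) (∼-reflexive refl (ring (+ k)) refl)
      where ring : ∀ K → -1ℤ * (+ 8 * K) + - + 4 * 1ℤ ≡ - (+ 8 * K) - + 4
            ring = solve-∀

    h³ : ℕ
    h³ = h ℕ.* h ℕ.* h

    8*h³≡1 : + 8 * + h³ ≡ 1ℤ mod m
    8*h³≡1 = begin
      + 8 * + h³                          ≡⟨ cong (+ 8 *_) (trans (ℤ.pos-* (h ℕ.* h) h) (cong (_* + h) (ℤ.pos-* h h))) ⟩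
      + 8 * (+ h * + h * + h)             ≡⟨ ring (+ h) ⟩
      + 2 * + h * (+ 2 * + h) * (+ 2 * + h) ≈⟨ *-cong-mod (*-cong-mod half half) half ⟩
      1ℤ                                  ∎
      where
      open ≡-mod-Reasoning m
      ring : ∀ H → + 8 * (H * H * H) ≡ + 2 * H * (+ 2 * H) * (+ 2 * H)
      ring = solve-∀

    *8-cancel-mod : ∀ {a b} → + 8 * a ≡ + 8 * b mod m → a ≡ b mod m
    *8-cancel-mod {a} {b} 8a≡8b = begin
      a                      ≡⟨ ℤ.*-identityˡ a ⟨
      1ℤ * a                 ≈⟨ *-cong-mod 8*h³≡1 (mod-refl {a = a}) ⟨
      + 8 * + h³ * a         ≡⟨ ring (+ h³) a ⟩
      + h³ * (+ 8 * a)       ≈⟨ *-congˡ-mod (+ h³) 8a≡8b ⟩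
      + h³ * (+ 8 * b)       ≡⟨ ring (+ h³) b ⟨
      + 8 * + h³ * b         ≈⟨ *-cong-mod 8*h³≡1 (mod-refl {a = b}) ⟩
      1ℤ * b                 ≡⟨ ℤ.*-identityˡ b ⟩
      b                      ∎
      where
      open ≡-mod-Reasoning m
      ring : ∀ H a → + 8 * H * a ≡ H * (+ 8 * a)
      ring = solve-∀

    σ₁-order : HasOrder (σ₁ n m) (2 ℕ.* n)
    σ₁-order = HasOrder-⟦⟧ (σ₁≈⟦g₁⟧ odd-n) (ℕ.≤-trans (ℕ.≤-trans (s≤s z≤n) 2<n) (ℕ.m≤n*m n 2))
      (∼-trans (g₁^ (2 ℕ.* n)) (record
        { ε-eq = refl ; b-eq = mod-trans (mod-reflexive (ℤ.pos-* 2 n)) (multiple≡0-mod (+ 2))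
        ; δ-eq = alt-even n ; l-eq = mod-refl ; u-eq = mod-refl }))
      nontrivial
      where
      nontrivial : ∀ j → 1 ≤ j → j < 2 ℕ.* n → ¬ g₁ ^ j ∼ 1A
      nontrivial j 1≤j j<2n g₁^j∼1 = contradiction (trans (sym (alt-odd (subst Odd (sym j≡n) odd-n))) (δ-eq p)) λ ()
        where
        p : affine Sign.+ (+ j) (alt j) 0ℤ 0ℤ ∼ 1A
        p = ∼-trans (∼-sym (g₁^ j)) g₁^j∼1
        j≡n : j ≡ n
        j≡n = multiple<2n⇒≡n 1≤j j<2n (b-eq p)

    σ₂-order : HasOrder (σ₂ n m) (2 ℕ.* m)
    σ₂-order = HasOrder-⟦⟧ (σ₂≈⟦g₂⟧ odd-n) (ℕ.≤-trans (ℕ.≤-trans (s≤s z≤n) 2<m) (ℕ.m≤n*m m 2))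
      (∼-trans (g₂^even m) (record
        { ε-eq = refl ; b-eq = mod-refl ; δ-eq = refl ; l-eq = multiple≡0-mod (+ 8) ; u-eq = mod-refl }))
      nontrivial
      where
      nontrivial : ∀ j → 1 ≤ j → j < 2 ℕ.* m → ¬ g₂ ^ j ∼ 1A
      nontrivial j 1≤j j<2m g₂^j∼1 with even-or-odd j
      ... | inj₂ (k , refl) = contradiction (ε-eq (∼-trans (∼-sym (g₂^odd k)) g₂^j∼1)) λ ()
      ... | inj₁ (k , refl) = contradiction k≡0 (ℕ.<⇒≢ 0<k ∘ sym)
        where
        0<k : 0 < k
        0<k = ℕ.*-cancelˡ-< 2 0 k 1≤j
        k<m : k < m
        k<m = ℕ.*-cancelˡ-< 2 k m j<2m
        k≡0 : k ≡ 0
        k≡0 = residue-unique k<m (ℕ.≤-<-trans z≤n k<m)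
                (*8-cancel-mod (l-eq (∼-trans (∼-sym (g₂^even k)) g₂^j∼1)))

    σ₁σ₂-order : HasOrder (σ₁ n m ⨾ σ₂ n m) 2
    σ₁σ₂-order = HasOrder-⟦⟧ σ₁σ₂≈⟦g₁g₂⟧ (s≤s z≤n) ∼-refl nontrivial
      where
      σ₁σ₂≈⟦g₁g₂⟧ : (σ₁ n m ⨾ σ₂ n m) ≈ ⟦ g₁ · g₂ ⟧
      σ₁σ₂≈⟦g₁g₂⟧ v = trans (⨾-cong (σ₁≈⟦g₁⟧ odd-n) (σ₂≈⟦g₂⟧ odd-n) v) (⟦⟧-· g₁ g₂ v)
      nontrivial : ∀ j → 1 ≤ j → j < 2 → ¬ (g₁ · g₂) ^ j ∼ 1A
      nontrivial 1 _ _ g₁g₂∼1 = contradiction (ε-eq g₁g₂∼1) λ ()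
      nontrivial (suc (suc _)) _ (s≤s (s≤s ()))

    record Gen (d : Affine) : Set where
      constructor gen
      field inGen : InGen (σ₁ n m) (σ₂ n m) ⟦ d ⟧
    open Gen

    Gen-resp : ∀ {d d′} → d ∼ d′ → Gen d → Gen d′
    Gen-resp d∼d′ (gen p) = gen (g-ext p (⟦⟧-cong d∼d′))

    Gen-1A : Gen 1A
    Gen-1A = gen (g-ext g-id (sym ∘ ⟦1A⟧))

    Gen-· : ∀ {d d′} → Gen d → Gen d′ → Gen (d · d′)
    Gen-· {d} {d′} (gen p) (gen q) = gen (g-ext (g-mul p q) (⟦⟧-· d d′))

    Gen-⁻¹ : ∀ {d} → Gen d → Gen (d ⁻¹)
    Gen-⁻¹ {d} (gen p) = gen (g-inv p (⟦⟧-inverseʳ d) (⟦⟧-inverseˡ d))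

    Gen-^ : ∀ {d} k → Gen d → Gen (d ^ k)
    Gen-^ zero    p = Gen-1A
    Gen-^ (suc k) p = Gen-· (Gen-^ k p) p

    Gen-g₁ : Gen g₁
    Gen-g₁ = gen (g-ext g-a (σ₁≈⟦g₁⟧ odd-n))

    Gen-g₂ : Gen g₂
    Gen-g₂ = gen (g-ext g-b (σ₂≈⟦g₂⟧ odd-n))

    InGen⇒⟦⟧ : ∀ {f} → InGen (σ₁ n m) (σ₂ n m) f → Σ Affine λ d → f ≈ ⟦ d ⟧
    InGen⇒⟦⟧ g-id = 1A , sym ∘ ⟦1A⟧
    InGen⇒⟦⟧ g-a  = g₁ , σ₁≈⟦g₁⟧ odd-n
    InGen⇒⟦⟧ g-b  = g₂ , σ₂≈⟦g₂⟧ odd-n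
    InGen⇒⟦⟧ (g-mul p q) with InGen⇒⟦⟧ p | InGen⇒⟦⟧ q
    ... | d , f≈⟦d⟧ | d′ , g≈⟦d′⟧ = d · d′ , λ v → trans (⨾-cong f≈⟦d⟧ g≈⟦d′⟧ v) (⟦⟧-· d d′ v)
    InGen⇒⟦⟧ (g-inv {f} {g} p f⨾g≈id _) with InGen⇒⟦⟧ p
    ... | d , f≈⟦d⟧ = d ⁻¹ , λ v → begin
      g v                        ≡⟨ cong g (⟦⟧-inverseˡ d v) ⟨
      g (⟦ d ⟧ (⟦ d ⁻¹ ⟧ v))     ≡⟨ cong g (f≈⟦d⟧ (⟦ d ⁻¹ ⟧ v)) ⟨
      g (f (⟦ d ⁻¹ ⟧ v))         ≡⟨ f⨾g≈id (⟦ d ⁻¹ ⟧ v) ⟩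
      ⟦ d ⁻¹ ⟧ v                 ∎
      where open ≡-Reasoning
    InGen⇒⟦⟧ (g-ext p f≈g) with InGen⇒⟦⟧ p
    ... | d , f≈⟦d⟧ = d , λ v → trans (sym (f≈g v)) (f≈⟦d⟧ v)

    translation : Affine
    translation = g₁ ^ suc n

    translation∼ : translation ∼ affine Sign.+ 1ℤ Sign.+ 0ℤ 0ℤ
    translation∼ = ∼-trans (g₁^ (suc n)) (record
      { ε-eq = refl
      ; b-eq = mod-trans (+-cong-mod (mod-refl {a = 1ℤ}) modulus≡0-mod) (mod-reflexive (ℤ.+-identityʳ 1ℤ))
      ; δ-eq = cong (Sign._* Sign.-) (alt-odd odd-n) ; l-eq = mod-refl ; u-eq = mod-refl })

    vertical-flip : Affine
    vertical-flip = g₁ ^ n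

    vertical-flip∼ : vertical-flip ∼ affine Sign.+ 0ℤ Sign.- 0ℤ 0ℤ
    vertical-flip∼ = ∼-trans (g₁^ n) (record
      { ε-eq = refl ; b-eq = modulus≡0-mod ; δ-eq = alt-odd odd-n ; l-eq = mod-refl ; u-eq = mod-refl })

    8*h³*k≡k : ∀ k → + 8 * + (h³ ℕ.* k) ≡ + k mod m
    8*h³*k≡k k = begin
      + 8 * + (h³ ℕ.* k)   ≡⟨ cong (+ 8 *_) (ℤ.pos-* h³ k) ⟩
      + 8 * (+ h³ * + k)   ≡⟨ ℤ.*-assoc (+ 8) (+ h³) (+ k) ⟨
      + 8 * + h³ * + k     ≈⟨ *-cong-mod 8*h³≡1 (mod-refl {a = + k}) ⟩
      1ℤ * + k             ≡⟨ ℤ.*-identityˡ (+ k) ⟩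
      + k                  ∎
      where open ≡-mod-Reasoning m

    shear : ℕ → Affine
    shear L = g₂ ^ (2 ℕ.* (h³ ℕ.* L))

    shear∼ : ∀ L → shear L ∼ affine Sign.+ 0ℤ Sign.+ (+ L) 0ℤ
    shear∼ L = ∼-trans (g₂^even (h³ ℕ.* L)) (record
      { ε-eq = refl ; b-eq = mod-refl ; δ-eq = refl ; l-eq = 8*h³*k≡k L ; u-eq = mod-refl })

    lift : ℕ → Affine
    lift U = (translation · shear 8 · translation ⁻¹ · shear 8 ⁻¹) ^ (h³ ℕ.* U)

    lift∼ : ∀ U → lift U ∼ affine Sign.+ 0ℤ Sign.+ 0ℤ (+ U)
    lift∼ U = ∼-trans (^-cong (h³ ℕ.* U) commutator∼)
      (∼-trans (vertical^ (+ 8) (h³ ℕ.* U)) (record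
        { ε-eq = refl ; b-eq = mod-refl ; δ-eq = refl ; l-eq = mod-refl
        ; u-eq = mod-trans (mod-reflexive (ℤ.*-comm (+ (h³ ℕ.* U)) (+ 8))) (8*h³*k≡k U) }))
      where
      commutator∼ : translation · shear 8 · translation ⁻¹ · shear 8 ⁻¹ ∼ affine Sign.+ 0ℤ Sign.+ 0ℤ (+ 8)
      commutator∼ = ·-cong (·-cong (·-cong translation∼ (shear∼ 8)) (⁻¹-cong translation∼)) (⁻¹-cong (shear∼ 8))

    -- g₂ · vertical-flip is (i , y) ↦ (-i , y + 4i - 2); shear 4 and lift 2 cancel the 4i and the -2.
    horizontal-flip : Affine
    horizontal-flip = g₂ · vertical-flip · shear 4 · lift 2

    horizontal-flip∼ : horizontal-flip ∼ affine Sign.- 0ℤ Sign.+ 0ℤ 0ℤ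
    horizontal-flip∼ = ·-cong (·-cong (·-cong (∼-refl {g₂}) vertical-flip∼) (shear∼ 4)) (lift∼ 2)

    Gen-^ˢ : ∀ {d} ε → Gen d → Gen (d ^ˢ ε)
    Gen-^ˢ Sign.+ _ = Gen-1A
    Gen-^ˢ Sign.- p = p

    vertical-flip^ˢ : ∀ δ → vertical-flip ^ˢ δ ∼ affine Sign.+ 0ℤ δ 0ℤ 0ℤ
    vertical-flip^ˢ Sign.+ = ∼-refl
    vertical-flip^ˢ Sign.- = vertical-flip∼

    horizontal-flip^ˢ : ∀ ε → horizontal-flip ^ˢ ε ∼ affine ε 0ℤ Sign.+ 0ℤ 0ℤ
    horizontal-flip^ˢ Sign.+ = ∼-refl
    horizontal-flip^ˢ Sign.- = horizontal-flip∼

    word : Sign → ℕ → Sign → ℕ → ℕ → Affine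
    word ε B δ L U = vertical-flip ^ˢ δ · shear L · lift U · horizontal-flip ^ˢ ε · translation ^ B

    Gen-word : ∀ ε B δ L U → Gen (word ε B δ L U)
    Gen-word ε B δ L U = Gen-· (Gen-· (Gen-· (Gen-· (Gen-^ˢ δ Gen-vertical-flip) Gen-shear) Gen-lift)
                                           (Gen-^ˢ ε Gen-horizontal-flip)) (Gen-^ B Gen-translation)
      where
      Gen-translation : Gen translation
      Gen-translation = Gen-^ (suc n) Gen-g₁
      Gen-vertical-flip : Gen vertical-flip
      Gen-vertical-flip = Gen-^ n Gen-g₁
      Gen-shear : ∀ {L} → Gen (shear L)
      Gen-shear = Gen-^ _ Gen-g₂
      Gen-lift : ∀ {U} → Gen (lift U)
      Gen-lift = Gen-^ _ (Gen-· (Gen-· (Gen-· Gen-translation Gen-shear) (Gen-⁻¹ Gen-translation)) (Gen-⁻¹ Gen-shear))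
      Gen-horizontal-flip : Gen horizontal-flip
      Gen-horizontal-flip = Gen-· (Gen-· (Gen-· Gen-g₂ Gen-vertical-flip) Gen-shear) Gen-lift

    word∼ : ∀ ε B δ L U → word ε B δ L U ∼ affine ε (+ B) δ (+ L) (+ U)
    word∼ ε B δ L U = ∼-trans
      (·-cong (·-cong (·-cong (·-cong (vertical-flip^ˢ δ) (shear∼ L)) (lift∼ U)) (horizontal-flip^ˢ ε))
              (∼-trans (^-cong B translation∼) (horizontal^ B)))
      (normal-form ε (+ B) δ (+ L) (+ U))

    Rep : Set
    Rep = Sign × Fin n × Sign × Fin m × Fin m

    embed : Rep → Affine
    embed (ε , b , δ , l , u) = affine ε (toℤ b) δ (toℤ l) (toℤ u)

    Gen-embed : ∀ r → Gen (embed r)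
    Gen-embed (ε , b , δ , l , u) =
      Gen-resp (word∼ ε (toℕ b) δ (toℕ l) (toℕ u)) (Gen-word ε (toℕ b) δ (toℕ l) (toℕ u))

    reduce : Affine → Rep
    reduce (affine ε b δ l u) = ε , modFin i₀ b , δ , modFin j₀ l , modFin j₀ u
      where
      i₀ : Fin n
      i₀ = fromℕ< (ℕ.≤-trans (s≤s z≤n) 2<n)
      j₀ : Fin m
      j₀ = fromℕ< (ℕ.≤-trans (s≤s z≤n) 2<m)

    embed-reduce : ∀ d → embed (reduce d) ∼ d
    embed-reduce (affine ε b δ l u) = record
      { ε-eq = refl ; b-eq = toℤ-modFin _ b ; δ-eq = refl ; l-eq = toℤ-modFin _ l ; u-eq = toℤ-modFin _ u }

    embed-injective : ∀ r r′ → ⟦ embed r ⟧ ≈ ⟦ embed r′ ⟧ → r ≡ r′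
    embed-injective r@(ε , b , δ , l , u) r′@(ε′ , b′ , δ′ , l′ , u′) ⟦r⟧≈⟦r′⟧ =
      cong₂ _,_ (ε-eq r∼r′) (cong₂ _,_ (toℤ-injective-mod (b-eq r∼r′)) (cong₂ _,_ (δ-eq r∼r′)
        (cong₂ _,_ (toℤ-injective-mod (l-eq r∼r′)) (toℤ-injective-mod (u-eq r∼r′)))))
      where
      r∼r′ : embed r ∼ embed r′
      r∼r′ = ⟦⟧-injective 2<n 2<m (embed r) (embed r′) ⟦r⟧≈⟦r′⟧

    signs : List Sign
    signs = Sign.+ ∷ Sign.- ∷ []

    signed-fibres : List (Sign × Fin m × Fin m)
    signed-fibres = cartesianProduct signs (cartesianProduct (allFin m) (allFin m))

    reps : List Rep
    reps = cartesianProduct signs (cartesianProduct (allFin n) signed-fibres)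

    reps-unique : Unique reps
    reps-unique = cartesianProduct⁺ signs-unique (cartesianProduct⁺ (allFin⁺ n)
                    (cartesianProduct⁺ signs-unique (cartesianProduct⁺ (allFin⁺ m) (allFin⁺ m))))
      where
      signs-unique : Unique signs
      signs-unique = ((λ ()) ∷ []) ∷ [] ∷ []

    ∈-reps : ∀ r → r ∈ reps
    ∈-reps (ε , b , δ , l , u) = ∈-cartesianProduct⁺ (∈-signs ε) (∈-cartesianProduct⁺ (∈-allFin b)
                                   (∈-cartesianProduct⁺ (∈-signs δ) (∈-cartesianProduct⁺ (∈-allFin l) (∈-allFin u))))
      where
      ∈-signs : ∀ ε → ε ∈ signs
      ∈-signs Sign.+ = here refl
      ∈-signs Sign.- = there (here refl)

    length-reps : length reps ≡ 4 ℕ.* (m ℕ.* m) ℕ.* n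
    length-reps = trans lengths (ring n m)
      where
      length-allFin : ∀ k → length (allFin k) ≡ k
      length-allFin k = List.length-tabulate {n = k} id
      lengths : length reps ≡ 2 ℕ.* (n ℕ.* (2 ℕ.* (m ℕ.* m)))
      lengths =
        trans (length-cartesianProduct signs (cartesianProduct (allFin n) signed-fibres)) (cong (2 ℕ.*_)
        (trans (length-cartesianProduct (allFin n) signed-fibres) (cong₂ ℕ._*_ (length-allFin n)
        (trans (length-cartesianProduct signs (cartesianProduct (allFin m) (allFin m))) (cong (2 ℕ.*_)
        (trans (length-cartesianProduct (allFin m) (allFin m)) (cong₂ ℕ._*_ (length-allFin m) (length-allFin m))))))))
      ring : ∀ n m → 2 ℕ.* (n ℕ.* (2 ℕ.* (m ℕ.* m))) ≡ 4 ℕ.* (m ℕ.* m) ℕ.* n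
      ring = ℕ-Solver.solve-∀

    |G| : HasCard (InGen (σ₁ n m) (σ₂ n m)) (4 ℕ.* (m ℕ.* m) ℕ.* n)
    |G| = subst (HasCard _) length-reps (HasCard-enumeration reps reps-unique ∈-reps
      (⟦_⟧ ∘ embed) (inGen ∘ Gen-embed) embed-injective
      λ g g∈G → let d , g≈⟦d⟧ = InGen⇒⟦⟧ g∈G in
        reduce d , λ v → trans (g≈⟦d⟧ v) (⟦⟧-cong (∼-sym (embed-reduce d)) v))

open import Data.Nat using (ℕ; suc; _≤_; _*_)
open import Data.Product using (_×_; _,_)

lemma5p1 : (m s : ℕ) → 3 ≤ m → Odd m → 1 ≤ s → Odd s →
    HasOrder (σ₁ (s * m) m) (2 * (s * m))
    × HasOrder (σ₂ (s * m) m) (2 * m)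
    × HasOrder (σ₁ (s * m) m ⨾ σ₂ (s * m) m) 2
    × HasCard (InGen (σ₁ (s * m) m) (σ₂ (s * m) m)) (4 * (m * m) * (s * m))
-- The hypothesis 1 ≤ s is implied by Odd s.
lemma5p1 m s 3≤m odd-m@(q , m≡1+2q) _ odd-s = σ₁-order , σ₂-order , σ₁σ₂-order , |G|
  where
  open Subgroup s m (suc q) (half-mod-odd m≡1+2q) (odd-* odd-s odd-m) (m<n⇒m<o*n odd-s 3≤m) 3≤m
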